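{- Let $d\ge 1$. Suppose that two remaining problems (in the sense defined in the context) satisfy the complete-cycle elimination condition and have the same normalized histogram $H=(H_{a,r})_{a\ge 1,\,1\le r\le d}$. Then their numbers of invariant completions are equal. Thus the number $\Phi(H)$ of invariant completions of a remaining problem with histogram $H$ does not depend on the identities of the active cycles, on their chosen starting positions, or on the history of previously eliminated cycles.
   Context: All graphs are finite, simple and undirected. Fix an integer $d\ge1$. A remaining problem consists of: a finite set $X$ with a permutation $\pi$ of $X$; target degrees $\tau:X\to\{0,\dots,d\}$ constant on the cycles of $\pi$; a $\pi$-invariant set $A\subseteq X$ of active vertices (a union of complete cycles of $\pi$, fixed points being cycles of length 1), the other cycles having been eliminated; and a division of the unordered pairs of distinct elements of $X$ into decided and undecided pairs, where the decided pairs form a $\pi$-invariant set and a $\pi$-invariant subset $E_0$ of the decided pairs has been chosen as edges. For $v\in X$ the residual degree is $\rho(v)=\tau(v)-\#\{e\in E_0: v\in e\}$; it is constant on cycles of $\pi$. It is required that $\rho(v)=0$ for $v\notin A$, and (normalization: cycles of residual degree zero are removed from the active set) $1\le\rho(v)\le d$ for $v\in A$. The complete-cycle elimination condition says that every pair with at least one endpoint outside $A$ is already decided and that every pair of distinct vertices of $A$ is still undecided. The normalized histogram of the problem is the finitely supported array $H=(H_{a,r})_{a\ge1,\,1\le r\le d}$, where $H_{a,r}$ is the number of cycles of $\pi$ contained in $A$ that have length $a$ and whose vertices have residual degree $r$. An invariant completion is a set of undecided pairs that is invariant under $\pi$ (acting on unordered pairs) such that each $v\in A$ lies in exactly $\rho(v)$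 of its pairs. -}

module Defs where

open import Data.Bool.Base using (true; false)
open import Data.Fin.Base using (Fin; zero; suc; toℕ; fromℕ<)
open import Data.Fin.Permutation using (Permutation′; _⟨$⟩ʳ_)
open import Data.Fin.Properties using (_≟_; any?; all?; pigeonhole; toℕ<n; toℕ-fromℕ<; toℕ≤pred[n])
open import Data.Fin.Subset using (Subset; _∈_; _∉_; _⊆_; ∣_∣)
open import Data.Fin.Subset.Properties using (_∈?_; _⊆?_)
open import Data.Integer.Base as ℤ using (ℤ; +_; _⊖_; 0ℤ; 1ℤ)
import Data.Integer.Properties as ℤ
open import Data.List.Base using (List; []; _∷_; length; filter; cartesianProductWith)
open import Data.Nat.Base as ℕ using (ℕ; zero; suc; _+_; _∸_; _≤_; _<_)
import Data.Nat.Properties as ℕ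
open import Data.Nat.GeneralisedArithmetic using (fold; fold-+)
open import Data.Product using (∃; _×_; _,_; uncurry)
open import Data.Sum using (_⊎_)
open import Data.Vec.Base as Vec using (Vec; lookup)
open import Function.Bundles using (_⇔_; mk⇔; Equivalence)
open import Relation.Binary.PropositionalEquality
open import Relation.Nullary using (Dec; yes; no; ¬_)
open import Relation.Nullary.Decidable using (map′; _×-dec_; _→-dec_; ¬?)
open import Relation.Unary using (Decidable)

private
  variable
    n : ℕ

_⇔-dec_ : ∀ {P Q : Set} → Dec P → Dec Q → Dec (P ⇔ Q)
P? ⇔-dec Q? =
  map′ (uncurry mk⇔) (λ e → Equivalence.to e , Equivalence.from e)
       ((P? →-dec Q?) ×-dec (Q? →-dec P?))

-- Every vector of length n over the listed entries, once each when the list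
-- has no repetitions.
vectors : ∀ {A : Set} → List A → (n : ℕ) → List (Vec A n)
vectors xs zero    = Vec.[] ∷ []
vectors xs (suc n) = cartesianProductWith Vec._∷_ xs (vectors xs n)

subsets : (n : ℕ) → List (Subset n)
subsets = vectors (true ∷ false ∷ [])

count : ∀ {A : Set} {P : A → Set} → Decidable P → List A → ℕ
count P? xs = length (filter P? xs)

SameCycle : Permutation′ n → Fin n → Fin n → Set
SameCycle π v w = ∃ λ k → fold v (π ⟨$⟩ʳ_) k ≡ w

private
  wrap : (f : Fin n → Fin n) (v : Fin n) → ∃ λ j → j < n × fold v f j ≡ fold v f n
  wrap {n} f v
    with a , b , a<b , eq ← pigeonhole (ℕ.n<1+n n) (λ i → fold v f (toℕ i)) =
    n ∸ toℕ b + toℕ a , lt , val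
    where
    b≤n : toℕ b ≤ n
    b≤n = toℕ≤pred[n] b

    n∸b+b : n ∸ toℕ b + toℕ b ≡ n
    n∸b+b = ℕ.m∸n+n≡m b≤n

    lt : n ∸ toℕ b + toℕ a < n
    lt = subst (n ∸ toℕ b + toℕ a <_) n∸b+b (ℕ.+-monoʳ-< (n ∸ toℕ b) a<b)

    val : fold v f (n ∸ toℕ b + toℕ a) ≡ fold v f n
    val = begin
      fold v f (n ∸ toℕ b + toℕ a)          ≡⟨ fold-+ v f (n ∸ toℕ b) ⟩
      fold (fold v f (toℕ a)) f (n ∸ toℕ b) ≡⟨ cong (λ x → fold x f (n ∸ toℕ b)) eq ⟩
      fold (fold v f (toℕ b)) f (n ∸ toℕ b) ≡⟨ fold-+ v f (n ∸ toℕ b) ⟨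
      fold v f (n ∸ toℕ b + toℕ b)          ≡⟨ cong (fold v f) n∸b+b ⟩
      fold v f n                            ∎
      where open ≡-Reasoning

  bounded : (f : Fin n → Fin n) (v : Fin n) (k : ℕ) →
            ∃ λ j → j < n × fold v f j ≡ fold v f k
  bounded {suc n} f v zero = 0 , ℕ.z<s , refl
  bounded {n} f v (suc k) with j , j<n , eq ← bounded f v k | suc j ℕ.<? n
  ... | yes 1+j<n = suc j , 1+j<n , cong f eq
  ... | no  1+j≮n with refl ← ℕ.≤-antisym j<n (ℕ.≮⇒≥ 1+j≮n)
                  with i , i<n , eq′ ← wrap f v = i , i<n , trans eq′ (cong f eq)

sameCycle? : (π : Permutation′ n) (v w : Fin n) → Dec (SameCycle π v w)
sameCycle? {n} π v w = map′ to from (any? λ (j : Fin n) → fold v f (toℕ j) ≟ w)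
  where
  f = π ⟨$⟩ʳ_

  to : (∃ λ (j : Fin n) → fold v f (toℕ j) ≡ w) → SameCycle π v w
  to (j , eq) = toℕ j , eq

  from : SameCycle π v w → ∃ λ (j : Fin n) → fold v f (toℕ j) ≡ w
  from (k , eq) with j , j<n , eq′ ← bounded f v k =
    fromℕ< j<n , trans (cong (fold v f) (toℕ-fromℕ< j<n)) (trans eq′ eq)

-- Cycles are identified with their vertex sets; fixed points give singletons.
IsCycle : Permutation′ n → Subset n → Set
IsCycle π C = ∃ λ v → ∀ w → w ∈ C ⇔ SameCycle π v w

isCycle? : (π : Permutation′ n) → Decidable (IsCycle π)
isCycle? π C = any? λ v → all? λ w → (w ∈? C) ⇔-dec sameCycle? π v w

-- A set of unordered pairs of distinct points is represented by its symmetric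
-- adjacency matrix with empty diagonal: row u is the set of all v such that
-- {u, v} belongs to the set.
Matrix : ℕ → Set
Matrix n = Vec (Subset n) n

matrices : (n : ℕ) → List (Matrix n)
matrices n = vectors (subsets n) n

infix 4 ⟨_,_⟩∈_

⟨_,_⟩∈_ : Fin n → Fin n → Matrix n → Set
⟨ u , v ⟩∈ E = v ∈ lookup E u

⟨_,_⟩∈?_ : (u v : Fin n) (E : Matrix n) → Dec (⟨ u , v ⟩∈ E)
⟨ u , v ⟩∈? E = v ∈? lookup E u

IsPairSet : Matrix n → Set
IsPairSet E = (∀ u → ¬ ⟨ u , u ⟩∈ E) × (∀ u v → ⟨ u , v ⟩∈ E → ⟨ v , u ⟩∈ E)

isPairSet? : Decidable (IsPairSet {n})
isPairSet? E = (all? λ u → ¬? (⟨ u , u ⟩∈? E))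
         ×-dec (all? λ u → all? λ v → (⟨ u , v ⟩∈? E) →-dec (⟨ v , u ⟩∈? E))

Invariant : Permutation′ n → Matrix n → Set
Invariant π E = ∀ u v → ⟨ u , v ⟩∈ E ⇔ ⟨ π ⟨$⟩ʳ u , π ⟨$⟩ʳ v ⟩∈ E

invariant? : (π : Permutation′ n) → Decidable (Invariant π)
invariant? π E = all? λ u → all? λ v →
  (⟨ u , v ⟩∈? E) ⇔-dec (⟨ π ⟨$⟩ʳ u , π ⟨$⟩ʳ v ⟩∈? E)

-- For a pair set, the number of pairs containing v.
degree : Matrix n → Fin n → ℕ
degree E v = ∣ lookup E v ∣

record RemainingProblem (d : ℕ) : Set where
  field
    size : ℕ

  X : Set
  X = Fin size

  field
    π       : Permutation′ size
    τ       : X → Fin (suc d)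
    A       : Subset size
    Decided : Matrix size
    E₀      : Matrix size

  -- Integer subtraction, so that the conditions on ρ below also rule out
  -- vertices whose chosen edges exceed their target degree.
  ρ : X → ℤ
  ρ v = toℕ (τ v) ⊖ degree E₀ v

  field
    τ-constant        : ∀ {v w} → SameCycle π v w → τ v ≡ τ w
    A-invariant       : ∀ v → v ∈ A ⇔ π ⟨$⟩ʳ v ∈ A
    Decided-pairs     : IsPairSet Decided
    Decided-invariant : Invariant π Decided
    E₀-pairs          : IsPairSet E₀
    E₀-invariant      : Invariant π E₀
    E₀-decided        : ∀ u v → ⟨ u , v ⟩∈ E₀ → ⟨ u , v ⟩∈ Decided
    ρ-inactive        : ∀ v → v ∉ A → ρ v ≡ 0ℤ
    ρ-active          : ∀ v → v ∈ A → 1ℤ ℤ.≤ ρ v × ρ v ℤ.≤ + d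

module _ {d : ℕ} (P : RemainingProblem d) where
  open RemainingProblem P

  CompleteCycleElimination : Set
  CompleteCycleElimination =
    (∀ u v → u ≢ v → u ∉ A ⊎ v ∉ A → ⟨ u , v ⟩∈ Decided) ×
    (∀ u v → u ≢ v → u ∈ A → v ∈ A → ¬ ⟨ u , v ⟩∈ Decided)

  IsHistogramCycle : (a r : ℕ) → Subset size → Set
  IsHistogramCycle a r C =
    IsCycle π C × C ⊆ A × ∣ C ∣ ≡ a × (∀ v → v ∈ C → ρ v ≡ + r)

  isHistogramCycle? : ∀ a r → Decidable (IsHistogramCycle a r)
  isHistogramCycle? a r C =
    isCycle? π C ×-dec C ⊆? A ×-dec ∣ C ∣ ℕ.≟ a ×-dec
    (all? λ v → (v ∈? C) →-dec (ρ v ℤ.≟ + r))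

  -- Meaningful as the normalized histogram for 1 ≤ a and 1 ≤ r ≤ d.
  histogram : (a r : ℕ) → ℕ
  histogram a r = count (isHistogramCycle? a r) (subsets size)

  IsInvariantCompletion : Matrix size → Set
  IsInvariantCompletion F =
    IsPairSet F ×
    (∀ u v → ⟨ u , v ⟩∈ F → ¬ ⟨ u , v ⟩∈ Decided) ×
    Invariant π F ×
    (∀ v → v ∈ A → + degree F v ≡ ρ v)

  isInvariantCompletion? : Decidable IsInvariantCompletion
  isInvariantCompletion? F =
    isPairSet? F ×-dec
    (all? λ u → all? λ v → (⟨ u , v ⟩∈? F) →-dec ¬? (⟨ u , v ⟩∈? Decided)) ×-dec
    invariant? π F ×-dec
    (all? λ v → (v ∈? A) →-dec (+ degree F v ℤ.≟ ρ v))

  numInvariantCompletions : ℕ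
  numInvariantCompletions = count isInvariantCompletion? (matrices size)

SameHistogram : ∀ {d} → RemainingProblem d → RemainingProblem d → Set
SameHistogram {d} P Q =
  ∀ a r → 1 ≤ a → 1 ≤ r → r ≤ d → histogram P a r ≡ histogram Q a r

{-# OPTIONS --safe #-}

-- Call (a , r , i , j) the label of the vertex πʲ u, where u is a chosen vertex
-- of the i-th cycle of length a and residual degree r. Every active vertex has a
-- label, and whether two labels name the same vertex depends on the labels
-- alone: exactly when they differ only in j, and there by a multiple of a. So
-- "having a common label" is, for two problems with the same histogram, a
-- π-equivariant bijective relation between active vertices preserving residual
-- degrees. Transporting completions along it is injective, which bounds the
-- number of completions of P by that of Q; the situation is symmetric.
module Submission where

open import Defs
open import Data.Bool.Base using (true; false)
open import Data.Fin.Base using (Fin; zero; suc; toℕ; fromℕ<)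
open import Data.Fin.Permutation using (Permutation′; _⟨$⟩ʳ_; _⟨$⟩ˡ_; inverseˡ; inverseʳ)
open import Data.Fin.Properties
  using (_≟_; any?; pigeonhole; injective⇒≤; suc-injective; toℕ<n; fromℕ<-toℕ; fromℕ<-injective)
open import Data.Fin.Subset using (Subset; _∈_; _⊆_; ∣_∣)
open import Data.Fin.Subset.Properties using (_∈?_; ⊆-antisym)
open import Data.Integer.Base as ℤ using (+_; _⊖_)
import Data.Integer.Properties as ℤ
open import Data.List.Base as List using (List; []; _∷_; length; filter; upTo)
open import Data.List.Membership.Propositional using () renaming (_∈_ to _∈ˡ_)
open import Data.List.Membership.Propositional.Properties
  using (∈-lookup; ∈-map⁺; ∈-map⁻; ∈-filter⁺; ∈-filter⁻; ∈-upTo⁺; ∈-cartesianProductWith⁺)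
open import Data.List.Properties using (length-map; length-upTo)
open import Data.List.Relation.Unary.All as All using ([]; _∷_)
open import Data.List.Relation.Unary.Any using (here; there; index)
open import Data.List.Relation.Unary.Any.Properties using (lookup-index)
open import Data.List.Relation.Unary.AllPairs using ([]; _∷_)
open import Data.List.Relation.Unary.Unique.Propositional using (Unique)
import Data.List.Relation.Unary.Unique.Propositional.Properties as Unique
open import Data.Nat.Base as ℕ using (ℕ; zero; suc; _+_; _*_; _∸_; _≤_; _<_; >-nonZero)
import Data.Nat.Properties as ℕ
open import Data.Nat.DivMod using (_%_; _/_; m≡m%n+[m/n]*n; m%n<n)
open import Data.Nat.GeneralisedArithmetic using (fold; fold-+)
open import Data.Product using (∃; ∃₂; _×_; _,_; proj₁; proj₂)
open import Data.Sum using (inj₁; inj₂)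
open import Data.Vec.Base as Vec using (Vec; lookup; tabulate)
open import Data.Vec.Properties
  using (lookup∘tabulate; []=⇒lookup; lookup⇒[]=; ∷-injective)
open import Data.Vec.Relation.Binary.Pointwise.Extensional using (ext; Pointwise-≡⇒≡)
open import Function.Base using (_∘_; flip)
open import Function.Bundles using (_⇔_; mk⇔; Equivalence)
open import Relation.Binary.PropositionalEquality
open import Relation.Nullary using (Dec; yes; no; ¬_; does)
open import Relation.Nullary.Decidable using (dec-true; map′; _×-dec_; decidable-stable)
open import Relation.Nullary.Negation using (contradiction)
open import Relation.Unary using (Decidable)

open Equivalence using (to; from)

private
  variable
    m n d : ℕ
    Y Z : Set

-- Duplicate-free enumerations and comparison of counts.

lookup-injective : {xs : List Y} → Unique xs → ∀ i j →
                   List.lookup xs i ≡ List.lookup xs j → i ≡ j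
lookup-injective (_ ∷ _)    zero    zero    _  = refl
lookup-injective (x≢ ∷ _)   zero    (suc j) eq = contradiction eq (All.lookup x≢ (∈-lookup j))
lookup-injective (x≢ ∷ _)   (suc i) zero    eq = contradiction (sym eq) (All.lookup x≢ (∈-lookup i))
lookup-injective (_ ∷ xs!)  (suc i) (suc j) eq = cong suc (lookup-injective xs! i j eq)

-- Pigeonhole for a relation: each entry of `xs` picks the position of a related entry of `ys`. A
-- shared position means a shared related entry, so the choice is injective. Only `xs` has to be
-- free of repetitions.
length-≤ : (R : Y → Z → Set) {xs : List Y} {ys : List Z} → Unique xs →
           (∀ {x} → x ∈ˡ xs → ∃ λ y → y ∈ˡ ys × R x y) →
           (∀ {x x′ y} → x ∈ˡ xs → x′ ∈ˡ xs → R x y → R x′ y → x ≡ x′) →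
           length xs ≤ length ys
length-≤ R {xs} {ys} xs! total inj = injective⇒≤ {f = position} position-injective
  where
  image : ∀ i → ∃ λ y → y ∈ˡ ys × R (List.lookup xs i) y
  image i = total (∈-lookup i)

  position : Fin (length xs) → Fin (length ys)
  position i = index (proj₁ (proj₂ (image i)))

  related : ∀ i → R (List.lookup xs i) (List.lookup ys (position i))
  related i with y , y∈ , r ← image i = subst (R _) (lookup-index y∈) r

  position-injective : ∀ {i j} → position i ≡ position j → i ≡ j
  position-injective {i} {j} eq = lookup-injective xs! i j
    (inj (∈-lookup i) (∈-lookup j) (related i)
         (subst (λ k → R _ (List.lookup ys k)) (sym eq) (related j)))

vectors-unique : {xs : List Y} → Unique xs → ∀ n → Unique (vectors xs n)
vectors-unique xs! zero    = [] ∷ []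
vectors-unique xs! (suc n) =
  Unique.cartesianProductWith⁺ Vec._∷_ ∷-injective xs! (vectors-unique xs! n)

∈-vectors : {xs : List Y} → (∀ x → x ∈ˡ xs) → (v : Vec Y n) → v ∈ˡ vectors xs n
∈-vectors full Vec.[]      = here refl
∈-vectors full (x Vec.∷ v) = ∈-cartesianProductWith⁺ Vec._∷_ (full x) (∈-vectors full v)

subsets-unique : ∀ n → Unique (subsets n)
subsets-unique = vectors-unique (((λ ()) ∷ []) ∷ [] ∷ [])

∈-subsets : (S : Subset n) → S ∈ˡ subsets n
∈-subsets = ∈-vectors λ { true → here refl ; false → there (here refl) }

count-≤ : {P : Y → Set} {Q : Z → Set} (P? : Decidable P) (Q? : Decidable Q)
          {xs : List Y} {ys : List Z} → Unique xs → (∀ y → y ∈ˡ ys) →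
          (f : Y → Z) → (∀ x → P x → Q (f x)) →
          (∀ x x′ → P x → P x′ → f x ≡ f x′ → x ≡ x′) →
          count P? xs ≤ count Q? ys
count-≤ P? Q? {xs} xs! full f pres inj = length-≤ (λ x y → f x ≡ y) (Unique.filter⁺ P? xs!)
  (λ x∈ → _ , ∈-filter⁺ Q? (full _) (pres _ (holds x∈)) , refl)
  (λ x∈ x′∈ eq eq′ → inj _ _ (holds x∈) (holds x′∈) (trans eq (sym eq′)))
  where
  holds : ∀ {x} → x ∈ˡ filter P? xs → _
  holds = proj₂ ∘ ∈-filter⁻ P? {xs = xs}

-- Cardinalities of finite subsets.

members : Subset n → List (Fin n)
members Vec.[]          = []
members (true  Vec.∷ S) = zero ∷ List.map suc (members S)
members (false Vec.∷ S) = List.map suc (members S)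

length-members : (S : Subset n) → length (members S) ≡ ∣ S ∣
length-members Vec.[]          = refl
length-members (true  Vec.∷ S) = cong suc (trans (length-map suc (members S)) (length-members S))
length-members (false Vec.∷ S) = trans (length-map suc (members S)) (length-members S)

∈-members⁺ : {S : Subset n} {v : Fin n} → v ∈ S → v ∈ˡ members S
∈-members⁺ {S = true  Vec.∷ S} Vec.here       = here refl
∈-members⁺ {S = true  Vec.∷ S} (Vec.there v∈) = there (∈-map⁺ suc (∈-members⁺ v∈))
∈-members⁺ {S = false Vec.∷ S} (Vec.there v∈) = ∈-map⁺ suc (∈-members⁺ v∈)

∈-members⁻ : {S : Subset n} {v : Fin n} → v ∈ˡ members S → v ∈ S
∈-members⁻ {S = true  Vec.∷ S} (here refl) = Vec.here
∈-members⁻ {S = true  Vec.∷ S} (there v∈) with _ , w∈ , refl ← ∈-map⁻ suc v∈ = Vec.there (∈-members⁻ w∈)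
∈-members⁻ {S = false Vec.∷ S} v∈         with _ , w∈ , refl ← ∈-map⁻ suc v∈ = Vec.there (∈-members⁻ w∈)

members-unique : (S : Subset n) → Unique (members S)
members-unique Vec.[]          = []
members-unique (true  Vec.∷ S) =
  All.tabulate (λ v∈ → λ { refl → zero∉ v∈ }) ∷ Unique.map⁺ suc-injective (members-unique S)
  where
  zero∉ : ¬ (zero ∈ˡ List.map suc (members S))
  zero∉ v∈ with () ← proj₂ (proj₂ (∈-map⁻ suc v∈))
members-unique (false Vec.∷ S) = Unique.map⁺ suc-injective (members-unique S)

-- Because the bound takes a relation, it can be applied to a partial bijection and then to its
-- converse; the two applications together give equality of cardinalities.
∣∣-≤ : (R : Fin m → Fin n → Set) {S : Subset m} {T : Subset n} →
       (∀ {u} → u ∈ S → ∃ λ x → x ∈ T × R u x) →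
       (∀ {u v x} → R u x → R v x → u ≡ v) →
       ∣ S ∣ ≤ ∣ T ∣
∣∣-≤ R {S} {T} total inj = subst₂ _≤_ (length-members S) (length-members T)
  (length-≤ R (members-unique S)
    (λ u∈ → let x , x∈ , r = total (∈-members⁻ u∈) in x , ∈-members⁺ x∈ , r)
    (λ _ _ → inj))

module _ {P : Fin n → Set} (P? : Decidable P) where

  ⟦_⟧ : Subset n
  ⟦_⟧ = tabulate (does ∘ P?)

  ∈-⟦⟧ : ∀ v → v ∈ ⟦_⟧ ⇔ P v
  ∈-⟦⟧ v = mk⇔ ∈⇒P P⇒∈
    where
    P⇒∈ : P v → v ∈ ⟦_⟧
    P⇒∈ p = lookup⇒[]= v _ (trans (lookup∘tabulate _ v) (dec-true (P? v) p))

    ∈⇒P : v ∈ ⟦_⟧ → P v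
    ∈⇒P v∈ with P? v | trans (sym (lookup∘tabulate (does ∘ P?) v)) ([]=⇒lookup v∈)
    ... | yes p | _  = p
    ... | no _  | ()

-- Iterates and cycles of a permutation.

module _ (π : Permutation′ n) where

  private
    f : Fin n → Fin n
    f = π ⟨$⟩ʳ_

  ⟨$⟩ʳ-injective : ∀ {u v} → f u ≡ f v → u ≡ v
  ⟨$⟩ʳ-injective eq = trans (sym (inverseˡ π)) (trans (cong (π ⟨$⟩ˡ_) eq) (inverseˡ π))

  fold-injective : ∀ k {u v} → fold u f k ≡ fold v f k → u ≡ v
  fold-injective zero    eq = eq
  fold-injective (suc k) eq = fold-injective k (⟨$⟩ʳ-injective eq)

  fold-cancel : ∀ {i j u} → i ≤ j → fold u f i ≡ fold u f j → fold u f (j ∸ i) ≡ u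
  fold-cancel {i} {j} {u} i≤j eq = fold-injective i (begin
    fold (fold u f (j ∸ i)) f i ≡⟨ fold-+ u f i ⟨
    fold u f (i + (j ∸ i))      ≡⟨ cong (fold u f) (ℕ.m+[n∸m]≡n i≤j) ⟩
    fold u f j                  ≡⟨ eq ⟨
    fold u f i                  ∎)
    where open ≡-Reasoning

  fold-period : ∀ {u p} → fold u f p ≡ u → ∀ j q → fold u f (j + q * p) ≡ fold u f j
  fold-period {u} {p} eq j q = trans (fold-+ u f j) (cong (λ v → fold v f j) (multiple q))
    where
    multiple : ∀ q → fold u f (q * p) ≡ u
    multiple zero    = refl
    multiple (suc q) = trans (fold-+ u f p) (trans (cong (λ v → fold v f p) (multiple q)) eq)

  module _ {C : Subset n} {u : Fin n} (C-cycle : ∀ w → w ∈ C ⇔ SameCycle π u w) where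

    -- Reducing exponents modulo a return time `p` shows that the iterates with exponent below `p`
    -- already exhaust the cycle.
    ∣cycle∣≤ : ∀ {p} → 1 ≤ p → fold u f p ≡ u → ∣ C ∣ ≤ p
    ∣cycle∣≤ {p} 1≤p eq = subst₂ _≤_ (length-members C) (length-upTo p)
      (length-≤ (λ w j → fold u f j ≡ w) (members-unique C) total
        (λ _ _ eq₁ eq₂ → trans (sym eq₁) eq₂))
      where
      instance _ = >-nonZero 1≤p

      total : ∀ {w} → w ∈ˡ members C → ∃ λ j → j ∈ˡ upTo p × fold u f j ≡ w
      total w∈ with k , refl ← to (C-cycle _) (∈-members⁻ w∈) =
        k % p , ∈-upTo⁺ (m%n<n k p) ,
        trans (sym (fold-period eq (k % p) (k / p))) (cong (fold u f) (sym (m≡m%n+[m/n]*n k p)))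

    fold∈members : ∀ k → fold u f k ∈ˡ members C
    fold∈members k = ∈-members⁺ (from (C-cycle _) (k , refl))

    -- Two of the first `∣ C ∣ + 1` iterates coincide. Their distance is a positive return time of
    -- at most `∣ C ∣`, and every positive return time is at least `∣ C ∣`, so it equals `∣ C ∣`.
    fold-∣cycle∣ : fold u f ∣ C ∣ ≡ u
    fold-∣cycle∣ = trans (cong (fold u f) (ℕ.≤-antisym (∣cycle∣≤ (ℕ.m<n⇒0<n∸m i<j) periodic) bound)) periodic
      where
      repetition = pigeonhole (ℕ.n<1+n (length (members C))) (λ i → index (fold∈members (toℕ i)))
      i = toℕ (proj₁ repetition)
      j = toℕ (proj₁ (proj₂ repetition))

      i<j : i < j
      i<j = proj₁ (proj₂ (proj₂ repetition))

      periodic : fold u f (j ∸ i) ≡ u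
      periodic = fold-cancel (ℕ.<⇒≤ i<j)
        (trans (lookup-index (fold∈members i))
          (trans (cong (List.lookup (members C)) (proj₂ (proj₂ (proj₂ repetition))))
            (sym (lookup-index (fold∈members j)))))

      bound : j ∸ i ≤ ∣ C ∣
      bound = ℕ.≤-trans (ℕ.m∸n≤m j i)
        (subst (j ≤_) (length-members C) (ℕ.s≤s⁻¹ (toℕ<n (proj₁ (proj₂ repetition)))))

    1≤∣cycle∣ : 1 ≤ ∣ C ∣
    1≤∣cycle∣ = subst (1 ≤_) (length-members C)
      (ℕ.≤-trans (ℕ.s≤s ℕ.z≤n) (toℕ<n (index (∈-members⁺ (from (C-cycle u) (0 , refl))))))

    -- The remainder of `k` modulo `∣ C ∣` is again a return time. It lies below `∣ C ∣`, the least
    -- positive one, and is therefore zero.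
    ∣cycle∣-divides : ∀ {k} → fold u f k ≡ u → ∃ λ q → k ≡ q * ∣ C ∣
    ∣cycle∣-divides {k} eq = k / a , helper (k % a) (m%n<n k a) (m≡m%n+[m/n]*n k a)
      where
      a = ∣ C ∣
      instance _ = >-nonZero 1≤∣cycle∣

      helper : ∀ s → s < a → k ≡ s + (k / a) * a → k ≡ (k / a) * a
      helper zero    _   k≡ = k≡
      helper (suc s) s<a k≡ = contradiction (∣cycle∣≤ (ℕ.s≤s ℕ.z≤n)
        (trans (sym (fold-period fold-∣cycle∣ (suc s) (k / a))) (trans (cong (fold u f) (sym k≡)) eq)))
        (ℕ.<⇒≱ s<a)

    -- The conclusion is congruence modulo `∣ C ∣`, written with multiples on both sides so that it
    -- is symmetric and needs no subtraction.
    fold-coincide : ∀ {i j} → fold u f i ≡ fold u f j →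
                    ∃₂ λ x y → i + x * ∣ C ∣ ≡ j + y * ∣ C ∣
    fold-coincide {i} {j} eq with ℕ.≤-total i j
    ... | inj₁ i≤j with q , j∸i≡ ← ∣cycle∣-divides (fold-cancel i≤j eq) =
      q , 0 , trans (cong (_+_ i) (sym j∸i≡)) (trans (ℕ.m+[n∸m]≡n i≤j) (sym (ℕ.+-identityʳ j)))
    ... | inj₂ j≤i with q , i∸j≡ ← ∣cycle∣-divides (fold-cancel j≤i (sym eq)) =
      0 , q , sym (trans (cong (_+_ j) (sym i∸j≡)) (trans (ℕ.m+[n∸m]≡n j≤i) (sym (ℕ.+-identityʳ i))))

    cycle-return : ∀ {v} → SameCycle π u v → SameCycle π v u
    -- The remaining steps complete `k` full turns; the subtraction is exact since the cycle is
    -- nonempty, so `k` is at most `k * ∣ C ∣`.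
    cycle-return (k , refl) = k * ∣ C ∣ ∸ k , trans (sym (fold-+ u f (k * ∣ C ∣ ∸ k)))
      (trans (cong (fold u f) (ℕ.m∸n+n≡m (ℕ.m≤m*n k ∣ C ∣ ⦃ >-nonZero 1≤∣cycle∣ ⦄)))
        (fold-period fold-∣cycle∣ 0 k))

  sameCycle-trans : ∀ {u v w} → SameCycle π u v → SameCycle π v w → SameCycle π u w
  sameCycle-trans {u} (k , refl) (l , refl) = l + k , fold-+ u f l

  cycles-equal : ∀ {C D v} → IsCycle π C → IsCycle π D → v ∈ C → v ∈ D → C ≡ D
  cycles-equal (u , C-cycle) (u′ , D-cycle) v∈C v∈D =
    ⊆-antisym (inside C-cycle D-cycle v∈C v∈D) (inside D-cycle C-cycle v∈D v∈C)
    where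
    inside : ∀ {C D u u′ v} → (∀ w → w ∈ C ⇔ SameCycle π u w) →
             (∀ w → w ∈ D ⇔ SameCycle π u′ w) → v ∈ C → v ∈ D → C ⊆ D
    inside Cc Dc v∈C v∈D w∈C = from (Dc _) (sameCycle-trans (to (Dc _) v∈D)
      (sameCycle-trans (cycle-return Cc (to (Cc _) v∈C)) (to (Cc _) w∈C)))

-- `π` carries the neighbours of `v` bijectively onto those of its image; the graph of `π` and its
-- converse give the two inequalities.
degree-invariant : (π : Permutation′ n) (E : Matrix n) → Invariant π E →
                   ∀ v → degree E v ≡ degree E (π ⟨$⟩ʳ v)
degree-invariant π E inv v = ℕ.≤-antisym
  (∣∣-≤ (λ u x → π ⟨$⟩ʳ u ≡ x)
    (λ u∈ → _ , to (inv _ _) u∈ , refl)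
    (λ eq eq′ → ⟨$⟩ʳ-injective π (trans eq (sym eq′))))
  (∣∣-≤ (λ x u → π ⟨$⟩ʳ u ≡ x)
    (λ x∈ → _ , from (inv _ _) (subst (_∈ lookup E (π ⟨$⟩ʳ v)) (sym (inverseʳ π)) x∈) , inverseʳ π)
    (λ eq eq′ → trans (sym eq) eq′))

-- Labels of active vertices.

record Label : Set where
  constructor mkLabel
  field
    cycleLength residual cycleIndex position : ℕ

infix 4 _≈_

-- Positions are compared modulo the cycle length. No problem is mentioned, so the same equivalence
-- decides equality of labelled vertices in every problem.
_≈_ : Label → Label → Set
mkLabel a r i j ≈ mkLabel a′ r′ i′ j′ =
  a ≡ a′ × r ≡ r′ × i ≡ i′ × ∃₂ λ x y → j + x * a ≡ j′ + y * a

-- The bounds on `a` and `r` delimit exactly the range on which `SameHistogram` compares the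
-- histograms, so validity passes between the two problems.
Valid : RemainingProblem d → Label → Set
Valid {d} P (mkLabel a r i j) = 1 ≤ a × 1 ≤ r × r ≤ d × i < histogram P a r

module Labelling (P : RemainingProblem d) where
  open RemainingProblem P

  A-closed : ∀ {v w} → v ∈ A → SameCycle π v w → w ∈ A
  A-closed {v} v∈A (k , refl) = go k
    where
    go : ∀ k → fold v (π ⟨$⟩ʳ_) k ∈ A
    go zero    = v∈A
    go (suc k) = to (A-invariant _) (go k)

  ρ-constant : ∀ {v w} → SameCycle π v w → ρ v ≡ ρ w
  ρ-constant {v} v~w@(k , refl) = cong₂ _⊖_ (cong toℕ (τ-constant v~w)) (go k)
    where
    go : ∀ k → degree E₀ v ≡ degree E₀ (fold v (π ⟨$⟩ʳ_) k)
    go zero    = refl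
    go (suc k) = trans (go k) (degree-invariant π E₀ E₀-invariant (fold v (π ⟨$⟩ʳ_) k))

  cycleAt : ∀ a r → Fin (histogram P a r) → Subset size
  cycleAt a r = List.lookup (filter (isHistogramCycle? P a r) (subsets size))

  cycleAt-isHistogramCycle : ∀ a r i → IsHistogramCycle P a r (cycleAt a r i)
  cycleAt-isHistogramCycle a r i =
    proj₂ (∈-filter⁻ (isHistogramCycle? P a r) {xs = subsets size} (∈-lookup i))

  cycleAt-injective : ∀ a r {i j} → cycleAt a r i ≡ cycleAt a r j → i ≡ j
  cycleAt-injective a r =
    lookup-injective (Unique.filter⁺ (isHistogramCycle? P a r) (subsets-unique size)) _ _

  -- The starting vertex is the witness contained in the proof of `IsCycle`, an arbitrary choice.
  base : ∀ a r → Fin (histogram P a r) → X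
  base a r i = proj₁ (proj₁ (cycleAt-isHistogramCycle a r i))

  ∈-cycleAt : ∀ a r i w → w ∈ cycleAt a r i ⇔ SameCycle π (base a r i) w
  ∈-cycleAt a r i = proj₂ (proj₁ (cycleAt-isHistogramCycle a r i))

  ∣cycleAt∣ : ∀ a r i → ∣ cycleAt a r i ∣ ≡ a
  ∣cycleAt∣ a r i = proj₁ (proj₂ (proj₂ (cycleAt-isHistogramCycle a r i)))

  orbit : ∀ a r → Fin (histogram P a r) → ℕ → X
  orbit a r i = fold (base a r i) (π ⟨$⟩ʳ_)

  orbit∈cycleAt : ∀ a r i j → orbit a r i j ∈ cycleAt a r i
  orbit∈cycleAt a r i j = from (∈-cycleAt a r i _) (j , refl)

  orbit∈A : ∀ a r i j → orbit a r i j ∈ A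
  orbit∈A a r i j = proj₁ (proj₂ (cycleAt-isHistogramCycle a r i)) (orbit∈cycleAt a r i j)

  ρ-orbit : ∀ a r i j → ρ (orbit a r i j) ≡ + r
  ρ-orbit a r i j =
    proj₂ (proj₂ (proj₂ (cycleAt-isHistogramCycle a r i))) _ (orbit∈cycleAt a r i j)

  orbit-period : ∀ a r i j x → orbit a r i (j + x * a) ≡ orbit a r i j
  orbit-period a r i = fold-period π
    (subst (λ k → orbit a r i k ≡ base a r i) (∣cycleAt∣ a r i) (fold-∣cycle∣ π (∈-cycleAt a r i)))

  orbit-coincide : ∀ a r i {j k} → orbit a r i j ≡ orbit a r i k →
                   ∃₂ λ x y → j + x * a ≡ k + y * a
  orbit-coincide a r i {j} {k} eq =
    subst (λ b → ∃₂ λ x y → j + x * b ≡ k + y * b) (∣cycleAt∣ a r i)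
      (fold-coincide π (∈-cycleAt a r i) eq)

  point : ∀ l → Valid P l → X
  point (mkLabel a r i j) (_ , _ , _ , i<) = orbit a r (fromℕ< i<) j

  point∈A : ∀ l (l-valid : Valid P l) → point l l-valid ∈ A
  point∈A (mkLabel a r i j) (_ , _ , _ , i<) = orbit∈A a r (fromℕ< i<) j

  ρ-point : ∀ l (l-valid : Valid P l) → ρ (point l l-valid) ≡ + Label.residual l
  ρ-point (mkLabel a r i j) (_ , _ , _ , i<) = ρ-orbit a r (fromℕ< i<) j

  point-cong : ∀ l l′ (v : Valid P l) (v′ : Valid P l′) → l ≈ l′ → point l v ≡ point l′ v′
  point-cong (mkLabel a r i j) (mkLabel _ _ _ k) (_ , _ , _ , i<) _ (refl , refl , refl , x , y , eq) =
    trans (sym (orbit-period a r _ j x))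
      (trans (cong (orbit a r (fromℕ< i<)) eq) (orbit-period a r _ k y))

  -- A common vertex forces the two named cycles to coincide. Their size gives the length, the
  -- vertex gives the residual degree, the repetition-free enumeration gives the index, and
  -- `orbit-coincide` gives the positions up to multiples of the length.
  point-injective : ∀ l l′ (v : Valid P l) (v′ : Valid P l′) → point l v ≡ point l′ v′ → l ≈ l′
  point-injective (mkLabel a r i j) (mkLabel a′ r′ i′ k) (_ , _ , _ , i<) (_ , _ , _ , i′<) eq
    with cycles-equal π (proj₁ (cycleAt-isHistogramCycle a r (fromℕ< i<)))
                        (proj₁ (cycleAt-isHistogramCycle a′ r′ (fromℕ< i′<)))
                        (orbit∈cycleAt a r _ j)
                        (subst (_∈ cycleAt a′ r′ (fromℕ< i′<)) (sym eq) (orbit∈cycleAt a′ r′ _ k))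
  ... | C≡D
    with refl ← trans (sym (∣cycleAt∣ a r (fromℕ< i<)))
                      (trans (cong ∣_∣ C≡D) (∣cycleAt∣ a′ r′ (fromℕ< i′<)))
       | refl ← ℤ.+-injective (trans (sym (ρ-orbit a r (fromℕ< i<) j))
                                     (trans (cong ρ eq) (ρ-orbit a′ r′ (fromℕ< i′<) k)))
    with refl ← fromℕ<-injective i i′ i< i′< (cycleAt-injective a r C≡D)
    = refl , refl , refl , orbit-coincide a r (fromℕ< i<) eq

  -- The cycle through `v` occurs in the enumeration for its own length and residual degree, and its
  -- base vertex reaches `v` after some number of steps.
  label : ∀ {v} → v ∈ A → ∃₂ λ l (l-valid : Valid P l) → point l l-valid ≡ v
  label {v} v∈A =
    mkLabel a r (toℕ i) (proj₁ base~v) , (1≤∣cycle∣ π ∈C , 1≤r , r≤d , toℕ<n i) ,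
    trans (cong (λ i → orbit a r i (proj₁ base~v)) (fromℕ<-toℕ i (toℕ<n i))) (proj₂ base~v)
    where
    C : Subset size
    C = ⟦ sameCycle? π v ⟧

    ∈C : ∀ w → w ∈ C ⇔ SameCycle π v w
    ∈C = ∈-⟦⟧ (sameCycle? π v)

    a r : ℕ
    a = ∣ C ∣
    -- Normalization makes `ρ v` positive, so the absolute value loses nothing and only turns it
    -- into a natural number.
    r = ℤ.∣ ρ v ∣

    ρ≡r : ρ v ≡ + r
    ρ≡r = sym (ℤ.0≤i⇒+∣i∣≡i (ℤ.≤-trans (ℤ.+≤+ ℕ.z≤n) (proj₁ (ρ-active v v∈A))))

    1≤r : 1 ≤ r
    1≤r = ℤ.drop‿+≤+ (subst (ℤ.1ℤ ℤ.≤_) ρ≡r (proj₁ (ρ-active v v∈A)))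

    r≤d : r ≤ d
    r≤d = ℤ.drop‿+≤+ (subst (ℤ._≤ + d) ρ≡r (proj₂ (ρ-active v v∈A)))

    C-isHistogramCycle : IsHistogramCycle P a r C
    C-isHistogramCycle = (v , ∈C) , (λ w∈C → A-closed v∈A (to (∈C _) w∈C)) , refl ,
      λ w w∈C → trans (sym (ρ-constant (to (∈C w) w∈C))) ρ≡r

    C∈ : C ∈ˡ filter (isHistogramCycle? P a r) (subsets size)
    C∈ = ∈-filter⁺ (isHistogramCycle? P a r) (∈-subsets C) C-isHistogramCycle

    i : Fin (histogram P a r)
    i = index C∈

    base~v : SameCycle π (base a r i) v
    base~v = to (∈-cycleAt a r i v) (subst (v ∈_) (lookup-index C∈) (from (∈C v) (0 , refl)))

-- Correspondences between active vertices.

record Correspondence (P Q : RemainingProblem d) : Set₁ where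
  private
    module P = RemainingProblem P
    module Q = RemainingProblem Q
  field
    R           : P.X → Q.X → Set
    R?          : ∀ u x → Dec (R u x)
    left-total  : ∀ {u} → u ∈ P.A → ∃ λ x → R u x
    right-total : ∀ {x} → x ∈ Q.A → ∃ λ u → R u x
    left-active  : ∀ {u x} → R u x → u ∈ P.A
    right-active : ∀ {u x} → R u x → x ∈ Q.A
    functional  : ∀ {u x y} → R u x → R u y → x ≡ y
    injective   : ∀ {u v x} → R u x → R v x → u ≡ v
    equivariant : ∀ {u x} → R u x → R (P.π ⟨$⟩ʳ u) (Q.π ⟨$⟩ʳ x)
    ρ-preserving : ∀ {u x} → R u x → P.ρ u ≡ Q.ρ x

-- The conditions are symmetric in the two problems, so an inequality proved from an arbitrary
-- correspondence also yields the opposite one.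
reverse : {P Q : RemainingProblem d} → Correspondence P Q → Correspondence Q P
reverse c = record
  { R            = flip R
  ; R?           = flip R?
  ; left-total   = right-total
  ; right-total  = left-total
  ; left-active  = right-active
  ; right-active = left-active
  ; functional   = injective
  ; injective    = functional
  ; equivariant  = equivariant
  ; ρ-preserving = sym ∘ ρ-preserving
  }
  where open Correspondence c

module _ {P Q : RemainingProblem d} (same : SameHistogram P Q) where
  private
    module P where
      open RemainingProblem P public
      open Labelling P public
    module Q where
      open RemainingProblem Q public
      open Labelling Q public

    valid-to : ∀ l → Valid P l → Valid Q l
    valid-to (mkLabel a r i j) (1≤a , 1≤r , r≤d , i<) =
      1≤a , 1≤r , r≤d , subst (i <_) (same a r 1≤a 1≤r r≤d) i<

    valid-from : ∀ l → Valid Q l → Valid P l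
    valid-from (mkLabel a r i j) (1≤a , 1≤r , r≤d , i<) =
      1≤a , 1≤r , r≤d , subst (i <_) (sym (same a r 1≤a 1≤r r≤d)) i<

    CommonLabel : P.X → Q.X → Set
    CommonLabel u x = ∃ λ l → ∃₂ λ (p : Valid P l) (q : Valid Q l) → P.point l p ≡ u × Q.point l q ≡ x

    -- Two labels of `u` are equivalent by injectivity in `P`; since the equivalence is independent
    -- of the problem, they name the same vertex of `Q`.
    functional : ∀ {u x y} → CommonLabel u x → CommonLabel u y → x ≡ y
    functional (l , p , q , eq , refl) (l′ , p′ , q′ , eq′ , refl) =
      Q.point-cong l l′ q q′ (P.point-injective l l′ p p′ (trans eq (sym eq′)))

    injective : ∀ {u v x} → CommonLabel u x → CommonLabel v x → u ≡ v
    injective (l , p , q , refl , eq) (l′ , p′ , q′ , refl , eq′) =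
      P.point-cong l l′ p p′ (Q.point-injective l l′ q q′ (trans eq (sym eq′)))

    left-total : ∀ {u} → u ∈ P.A → ∃ λ x → CommonLabel u x
    left-total u∈A with l , p , eq ← P.label u∈A =
      Q.point l (valid-to l p) , l , p , valid-to l p , eq , refl

    right-total : ∀ {x} → x ∈ Q.A → ∃ λ u → CommonLabel u x
    right-total x∈A with l , q , eq ← Q.label x∈A =
      P.point l (valid-from l q) , l , valid-from l q , q , refl , eq

    left-active : ∀ {u x} → CommonLabel u x → u ∈ P.A
    left-active (l , p , _ , refl , _) = P.point∈A l p

    right-active : ∀ {u x} → CommonLabel u x → x ∈ Q.A
    right-active (l , _ , q , _ , refl) = Q.point∈A l q

    -- Labels cannot be searched exhaustively. An active `u` has a computed partner `y`, however,
    -- and uniqueness of partners reduces the question to whether `y` is `x`.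
    commonLabel? : ∀ u x → Dec (CommonLabel u x)
    commonLabel? u x with u ∈? P.A
    ... | no  u∉A = no (u∉A ∘ left-active)
    ... | yes u∈A with y , u~y ← left-total u∈A =
      map′ (λ { refl → u~y }) (functional u~y) (y ≟ x)

    equivariant : ∀ {u x} → CommonLabel u x → CommonLabel (P.π ⟨$⟩ʳ u) (Q.π ⟨$⟩ʳ x)
    -- Applying the permutation advances the position by one on both sides.
    equivariant (mkLabel a r i j , p , q , refl , refl) = mkLabel a r i (suc j) , p , q , refl , refl

    ρ-preserving : ∀ {u x} → CommonLabel u x → P.ρ u ≡ Q.ρ x
    ρ-preserving (l , p , q , refl , refl) = trans (P.ρ-point l p) (sym (Q.ρ-point l q))

  correspondence : Correspondence P Q
  correspondence = record
    { R            = CommonLabel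
    ; R?           = commonLabel?
    ; left-total   = left-total
    ; right-total  = right-total
    ; left-active  = left-active
    ; right-active = right-active
    ; functional   = functional
    ; injective    = injective
    ; equivariant  = equivariant
    ; ρ-preserving = ρ-preserving
    }

-- Transport of completions along a correspondence.

module _ {P Q : RemainingProblem d} (c : Correspondence P Q)
         (P-elim : CompleteCycleElimination P) (Q-elim : CompleteCycleElimination Q) where
  open Correspondence c
  private
    module P = RemainingProblem P
    module Q = RemainingProblem Q

  Transported : Matrix P.size → Q.X → Q.X → Set
  Transported F x y = ∃₂ λ u v → R u x × R v y × ⟨ u , v ⟩∈ F

  transported? : ∀ F x y → Dec (Transported F x y)
  transported? F x y = any? λ u → any? λ v → R? u x ×-dec R? v y ×-dec (⟨ u , v ⟩∈? F)

  transport : Matrix P.size → Matrix Q.size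
  transport F = tabulate λ x → ⟦ transported? F x ⟧

  ∈-transport : ∀ F x y → ⟨ x , y ⟩∈ transport F ⇔ Transported F x y
  ∈-transport F x y = subst (λ row → y ∈ row ⇔ Transported F x y)
    (sym (lookup∘tabulate _ x)) (∈-⟦⟧ (transported? F x) y)

  ∈-transport⁺ : ∀ F {u v x y} → R u x → R v y → ⟨ u , v ⟩∈ F → ⟨ x , y ⟩∈ transport F
  ∈-transport⁺ F u~x v~y uv∈F = from (∈-transport F _ _) (_ , _ , u~x , v~y , uv∈F)

  ∈-transport⁻ : ∀ F {u v x y} → R u x → R v y → ⟨ x , y ⟩∈ transport F → ⟨ u , v ⟩∈ F
  ∈-transport⁻ F u~x v~y xy∈ with _ , _ , u′~x , v′~y , uv∈F ← to (∈-transport F _ _) xy∈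
    with refl ← injective u~x u′~x | refl ← injective v~y v′~y = uv∈F

  -- A pair with an endpoint outside `A` has already been decided, whereas completions use undecided
  -- pairs only.
  completion-active : ∀ F {u v} → IsInvariantCompletion P F → ⟨ u , v ⟩∈ F → u ∈ P.A × v ∈ P.A
  completion-active F {u} {v} ((irrefl , _) , undecided , _) uv∈F =
    decidable-stable (u ∈? P.A) (λ u∉A → undecided u v uv∈F (proj₁ P-elim u v u≢v (inj₁ u∉A))) ,
    decidable-stable (v ∈? P.A) (λ v∉A → undecided u v uv∈F (proj₁ P-elim u v u≢v (inj₂ v∉A)))
    where
    u≢v : u ≢ v
    u≢v refl = irrefl u uv∈F

  transport-completion : ∀ F → IsInvariantCompletion P F → IsInvariantCompletion Q (transport F)
  transport-completion F F-comp@((irrefl , symm) , undecided , inv , deg) =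
    (G-irrefl , G-symm) , G-undecided , G-inv , G-deg
    where
    G : Matrix Q.size
    G = transport F

    G-irrefl : ∀ x → ¬ ⟨ x , x ⟩∈ G
    G-irrefl x xx∈G with u , v , u~x , v~x , uv∈F ← to (∈-transport F x x) xx∈G
      with refl ← injective u~x v~x = irrefl u uv∈F

    G-symm : ∀ x y → ⟨ x , y ⟩∈ G → ⟨ y , x ⟩∈ G
    G-symm x y xy∈G with u , v , u~x , v~y , uv∈F ← to (∈-transport F x y) xy∈G =
      ∈-transport⁺ F v~y u~x (symm u v uv∈F)

    G-undecided : ∀ x y → ⟨ x , y ⟩∈ G → ¬ ⟨ x , y ⟩∈ Q.Decided
    G-undecided x y xy∈G with u , v , u~x , v~y , uv∈F ← to (∈-transport F x y) xy∈G =
      -- Both endpoints have partners, hence are active, and elimination leaves all pairs of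
      -- distinct active vertices undecided.
      proj₂ Q-elim x y (λ { refl → G-irrefl x xy∈G }) (right-active u~x) (right-active v~y)

    -- This is equivariance read backwards: `x` is active because `A` is invariant, so it has a
    -- partner, whose image must be `u` by injectivity.
    pullback : ∀ {u x} → R u (Q.π ⟨$⟩ʳ x) → ∃ λ u′ → R u′ x × P.π ⟨$⟩ʳ u′ ≡ u
    pullback u~πx with u′ , u′~x ← right-total (from (Q.A-invariant _) (right-active u~πx)) =
      u′ , u′~x , injective (equivariant u′~x) u~πx

    G-inv : Invariant Q.π G
    G-inv x y = mk⇔ forward backward
      where
      forward : ⟨ x , y ⟩∈ G → ⟨ Q.π ⟨$⟩ʳ x , Q.π ⟨$⟩ʳ y ⟩∈ G
      forward xy∈G with u , v , u~x , v~y , uv∈F ← to (∈-transport F _ _) xy∈G =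
        ∈-transport⁺ F (equivariant u~x) (equivariant v~y) (to (inv u v) uv∈F)

      backward : ⟨ Q.π ⟨$⟩ʳ x , Q.π ⟨$⟩ʳ y ⟩∈ G → ⟨ x , y ⟩∈ G
      backward πxπy∈G with _ , _ , u~πx , v~πy , uv∈F ← to (∈-transport F _ _) πxπy∈G
        with u , u~x , refl ← pullback u~πx | v , v~y , refl ← pullback v~πy =
        ∈-transport⁺ F u~x v~y (from (inv u v) uv∈F)

    -- The relation restricts to a bijection between the neighbours of `u` in `F` and those of `x`
    -- in `G`. Neighbours in `F` are active, so none lacks a partner.
    degree-preserved : ∀ {u x} → R u x → degree G x ≡ degree F u
    degree-preserved {u} {x} u~x = ℕ.≤-antisym
      (∣∣-≤ (flip R)
        (λ y∈ → let _ , v , _ , v~y , _ = to (∈-transport F x _) y∈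
                in v , ∈-transport⁻ F u~x v~y y∈ , v~y)
        functional)
      (∣∣-≤ R
        (λ v∈ → let y , v~y = left-total (proj₂ (completion-active F F-comp v∈))
                in y , ∈-transport⁺ F u~x v~y v∈ , v~y)
        injective)

    G-deg : ∀ x → x ∈ Q.A → + degree G x ≡ Q.ρ x
    G-deg x x∈A with u , u~x ← right-total x∈A =
      trans (cong +_ (degree-preserved u~x)) (trans (deg u (left-active u~x)) (ρ-preserving u~x))

  -- Every pair of a completion has active endpoints and hence leaves a trace in the transported
  -- matrix, from which it can be recovered.
  transport-reflects-⊆ : ∀ F F′ → IsInvariantCompletion P F →
                         transport F ≡ transport F′ → ∀ u → lookup F u ⊆ lookup F′ u
  transport-reflects-⊆ F F′ F-comp eq u {v} uv∈F
    with u∈A , v∈A ← completion-active F F-comp uv∈F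
    with x , u~x ← left-total u∈A | y , v~y ← left-total v∈A =
    ∈-transport⁻ F′ u~x v~y (subst (⟨ x , y ⟩∈_) eq (∈-transport⁺ F u~x v~y uv∈F))

  transport-injective : ∀ F F′ → IsInvariantCompletion P F → IsInvariantCompletion P F′ →
                        transport F ≡ transport F′ → F ≡ F′
  transport-injective F F′ F-comp F′-comp eq = Pointwise-≡⇒≡ (ext λ u →
    ⊆-antisym (transport-reflects-⊆ F F′ F-comp eq u) (transport-reflects-⊆ F′ F F′-comp (sym eq) u))

  numInvariantCompletions-≤ : numInvariantCompletions P ≤ numInvariantCompletions Q
  numInvariantCompletions-≤ = count-≤ (isInvariantCompletion? P) (isInvariantCompletion? Q)
    (vectors-unique (subsets-unique P.size) P.size) (∈-vectors ∈-subsets)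
    transport transport-completion transport-injective

theorem3p2 : (d : ℕ) → 1 ≤ d → (P Q : RemainingProblem d) →
    CompleteCycleElimination P → CompleteCycleElimination Q →
    SameHistogram P Q →
    numInvariantCompletions P ≡ numInvariantCompletions Q
theorem3p2 d _ P Q P-elim Q-elim same = ℕ.≤-antisym
  (numInvariantCompletions-≤ c P-elim Q-elim)
  (numInvariantCompletions-≤ (reverse c) Q-elim P-elim)
  where
  c : Correspondence P Q
  c = correspondence same
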